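{- For all non-negative integers $n$ and $p$, $$\sum_{k=1}^n\frac{1}{2^{2k}}\binom{2(k+p)}{k+p}\binom{k+p}{k}\left(O_{k+p}-O_p\right)=\frac{1}{2^{2n+1}}\,\frac{p+1}{2p+1}\binom{2(n+p+1)}{n+p+1}\binom{n+p+1}{n}\left(O_{n+p+1}-O_{p+1}\right).$$ In particular, $\sum_{k=1}^n\frac{O_k}{2^{2k}}\binom{2k}{k}=\frac{n+1}{2^{2n+1}}\binom{2(n+1)}{n+1}(O_{n+1}-1)$.
   Context: The odd harmonic numbers are $O_n=\sum_{k=1}^n\frac{1}{2k-1}$, $O_0=0$. -}

module Defs where

open import Data.Integer.Base using (+_)
open import Data.Nat.Base using (ℕ; zero; suc; _*_; _^_)
open import Data.Nat.Combinatorics using (_C_)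
open import Data.Nat.Properties using (m^n≢0)
open import Data.Rational.Base using (ℚ; 0ℚ; _+_; _/_)

infixr 6 sum₁

-- The range is 1 ≤ k ≤ n, so the index 0 is never evaluated.
sum₁ : ℕ → (ℕ → ℚ) → ℚ
sum₁ zero    f = 0ℚ
sum₁ (suc n) f = sum₁ n f + f (suc n)

syntax sum₁ n (λ k → e) = ∑[1≤ k ≤ n ] e

-- With k = suc n, the odd denominator 2k - 1 is suc (2 * n).
O : ℕ → ℚ
O zero    = 0ℚ
O (suc n) = O n + + 1 / suc (2 * n)

binom : ℕ → ℕ → ℚ
binom n k = + (n C k) / 1

1/2^_ : ℕ → ℚ
1/2^ m = (+ 1 / (2 ^ m)) {{m^n≢0 2 m}}

{-# OPTIONS --safe #-}
-- Induction on n: both sides vanish at n = 0, and the closed form telescopes.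
-- Put m = n + 1 + p, T = 2p + 1, K = 2m + 1 = T + 2(n + 1), and E = O m - O p.
-- Rewriting every binomial coefficient in terms of C(2m,m) and C(m,n+1), the step
-- reduces to 2(n + 1)/T (E - 1/T) + E = K/T (E + 1/K - 1/T).
module Submission where

open import Defs
open import Data.Integer.Base as ℤ using (+_)
import Data.Integer.Properties as ℤ
open import Data.Nat.Base using (ℕ; zero; suc; _+_; _*_; _∸_; _^_; _!; NonZero)
open import Data.Nat.Combinatorics using (_C_; nC1≡n; nCn≡1; nCk≡nC[n∸k]; nCk≡n!/k![n-k]!; k![n∸k]!∣n!)
open import Data.Nat.DivMod using (m/n*n≡m)
open import Data.Nat.Properties as ℕ using (_!*_!≢0; m^n≢0)
open import Data.Nat.Tactic.RingSolver using (solve-∀)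
open import Data.Product.Base using (_×_; _,_)
open import Data.Rational.Base as ℚ using (ℚ; 0ℚ; 1ℚ; _/_; toℚᵘ)
import Data.Rational.Properties as ℚ
open import Data.Rational.Solver using (module +-*-Solver)
open import Data.Rational.Unnormalised.Base as ℚᵘ using (mkℚᵘ; *≡*)
import Data.Rational.Unnormalised.Properties as ℚᵘ
open import Relation.Binary.PropositionalEquality using (_≡_; refl; sym; trans; cong; cong₂; module ≡-Reasoning)

-- Binomial coefficients

-- The factorial formula without division: the quotient is exact because `m ! * n !` divides
-- `(m + n) !`. Writing the upper index as a sum avoids a hypothesis `k ≤ n`.
[m+n]Cm*m!n!≡[m+n]! : ∀ m n → ((m + n) C m) * (m ! * n !) ≡ (m + n) !
[m+n]Cm*m!n!≡[m+n]! m n = begin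
  ((m + n) C m) * (m ! * n !)
    ≡⟨ cong (λ k → ((m + n) C m) * (m ! * k !)) (ℕ.m+n∸m≡n m n) ⟨
  ((m + n) C m) * (m ! * (m + n ∸ m) !)
    ≡⟨ cong (_* (m ! * (m + n ∸ m) !)) (nCk≡n!/k![n-k]! (ℕ.m≤m+n m n)) ⟩
  _
    ≡⟨ m/n*n≡m (k![n∸k]!∣n! (ℕ.m≤m+n m n)) ⟩
  (m + n) ! ∎
  where
  open ≡-Reasoning
  instance _ = m !* (m + n ∸ m) !≢0

-- Multiplied by the non-zero `m ! * n !`, both sides become `suc (m + n) !`.
C-absorbˡ : ∀ m n → (suc (m + n) C suc m) * suc m ≡ suc (m + n) * ((m + n) C m)
C-absorbˡ m n = ℕ.*-cancelʳ-≡ _ _ (m ! * n !) (begin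
  (suc (m + n) C suc m) * suc m * (m ! * n !)
    ≡⟨ assoc (suc (m + n) C suc m) (suc m) (m !) (n !) ⟩
  (suc (m + n) C suc m) * (suc m ! * n !)
    ≡⟨ [m+n]Cm*m!n!≡[m+n]! (suc m) n ⟩
  suc (m + n) * (m + n) !
    ≡⟨ cong (suc (m + n) *_) ([m+n]Cm*m!n!≡[m+n]! m n) ⟨
  suc (m + n) * (((m + n) C m) * (m ! * n !))
    ≡⟨ ℕ.*-assoc (suc (m + n)) ((m + n) C m) (m ! * n !) ⟨
  suc (m + n) * ((m + n) C m) * (m ! * n !) ∎)
  where
  open ≡-Reasoning
  instance _ = m !* n !≢0
  assoc : ∀ a b c d → a * b * (c * d) ≡ a * (b * c * d)
  assoc = solve-∀

C-absorbʳ : ∀ m n → (suc (m + n) C m) * suc n ≡ suc (m + n) * ((m + n) C m)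
C-absorbʳ m n = ℕ.*-cancelʳ-≡ _ _ (m ! * n !) (begin
  (suc (m + n) C m) * suc n * (m ! * n !)
    ≡⟨ assoc (suc (m + n) C m) (suc n) (m !) (n !) ⟩
  (suc (m + n) C m) * (m ! * suc n !)
    ≡⟨ cong (λ k → (k C m) * (m ! * suc n !)) (ℕ.+-suc m n) ⟨
  ((m + suc n) C m) * (m ! * suc n !)
    ≡⟨ [m+n]Cm*m!n!≡[m+n]! m (suc n) ⟩
  (m + suc n) !
    ≡⟨ cong _! (ℕ.+-suc m n) ⟩
  suc (m + n) * (m + n) !
    ≡⟨ cong (suc (m + n) *_) ([m+n]Cm*m!n!≡[m+n]! m n) ⟨
  suc (m + n) * (((m + n) C m) * (m ! * n !))
    ≡⟨ ℕ.*-assoc (suc (m + n)) ((m + n) C m) (m ! * n !) ⟨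
  suc (m + n) * ((m + n) C m) * (m ! * n !) ∎)
  where
  open ≡-Reasoning
  instance _ = m !* n !≢0
  assoc : ∀ a b c d → a * b * (c * d) ≡ a * (c * (b * d))
  assoc = solve-∀

-- The path is C(2m+2,m+1) to C(2m+1,m) to C(2m,m), by one absorption on each side. Each consumes a
-- factor `suc m`, hence the extra one that is cancelled, and 2m+2 = 2(m+1) gives it back.
C-central : ∀ m → ((2 * suc m) C suc m) * suc m ≡ 2 * (suc (2 * m) * ((2 * m) C m))
C-central m = ℕ.*-cancelʳ-≡ _ _ (suc m) (begin
  ((2 * suc m) C suc m) * suc m * suc m
    ≡⟨ cong (λ k → (k C suc m) * suc m * suc m) (2*suc m) ⟩
  (suc (m + suc m) C suc m) * suc m * suc m
    ≡⟨ cong (_* suc m) (C-absorbˡ m (suc m)) ⟩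
  suc (m + suc m) * ((m + suc m) C m) * suc m
    ≡⟨ cong (λ k → suc k * (k C m) * suc m) (ℕ.+-suc m m) ⟩
  suc (suc (m + m)) * (suc (m + m) C m) * suc m
    ≡⟨ ℕ.*-assoc (suc (suc (m + m))) (suc (m + m) C m) (suc m) ⟩
  suc (suc (m + m)) * ((suc (m + m) C m) * suc m)
    ≡⟨ cong (suc (suc (m + m)) *_) (C-absorbʳ m m) ⟩
  suc (suc (m + m)) * (suc (m + m) * ((m + m) C m))
    ≡⟨ cong (λ k → suc (suc (m + m)) * (suc k * (k C m))) (m+m m) ⟩
  suc (suc (m + m)) * (suc (2 * m) * ((2 * m) C m))
    ≡⟨ double m (suc (2 * m) * ((2 * m) C m)) ⟩
  2 * (suc (2 * m) * ((2 * m) C m)) * suc m ∎)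
  where
  open ≡-Reasoning
  2*suc : ∀ m → 2 * suc m ≡ suc (m + suc m)
  2*suc = solve-∀
  m+m : ∀ m → m + m ≡ 2 * m
  m+m = solve-∀
  double : ∀ m x → suc (suc (m + m)) * x ≡ 2 * x * suc m
  double = solve-∀

-- Raising `m` in C(m,k) with `k` fixed produces the factor `suc m` that `C-central` needs.
C-central-step : ∀ k n → let m = k + n in
  ((2 * suc m) C suc m) * ((suc m C k) * suc n) ≡ 2 * (suc (2 * m) * (((2 * m) C m) * (m C k)))
C-central-step k n = begin
  ((2 * suc m) C suc m) * ((suc m C k) * suc n)   ≡⟨ cong (((2 * suc m) C suc m) *_) (C-absorbʳ k n) ⟩
  ((2 * suc m) C suc m) * (suc m * (m C k))     ≡⟨ ℕ.*-assoc ((2 * suc m) C suc m) (suc m) (m C k) ⟨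
  ((2 * suc m) C suc m) * suc m * (m C k)       ≡⟨ cong (_* (m C k)) (C-central m) ⟩
  2 * (suc (2 * m) * ((2 * m) C m)) * (m C k) ≡⟨ assoc (suc (2 * m)) ((2 * m) C m) (m C k) ⟩
  2 * (suc (2 * m) * (((2 * m) C m) * (m C k))) ∎
  where
  open ≡-Reasoning
  m = k + n
  assoc : ∀ a b c → 2 * (a * b) * c ≡ 2 * (a * (b * c))
  assoc = solve-∀

-- Fractions

infix 8 ι_
-- `binom n k` is `ι (n C k)` by definition, so `ι-*` carries the natural number identities over to
-- `binom`.
ι_ : ℕ → ℚ
ι n = + n / 1

-- `_/_` divides out a gcd and is stuck on variables. The unnormalised fraction computes; its second
-- field is the denominator minus one.
toℚᵘ-/ : ∀ i d → toℚᵘ (i / suc d) ℚᵘ.≃ mkℚᵘ i d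
toℚᵘ-/ i d = ℚ.toℚᵘ-fromℚᵘ (mkℚᵘ i d)

ι-+ : ∀ m n → ι (m + n) ≡ ι m ℚ.+ ι n
ι-+ m n = ℚ.toℚᵘ-injective (begin
  toℚᵘ (ι (m + n))            ≈⟨ toℚᵘ-/ (+ (m + n)) 0 ⟩
  mkℚᵘ (+ (m + n)) 0          ≈⟨ ℚᵘ.≃-reflexive (cong (λ i → mkℚᵘ i 0) (sym drop-1)) ⟩
  mkℚᵘ (+ m) 0 ℚᵘ.+ mkℚᵘ (+ n) 0 ≈⟨ ℚᵘ.+-cong (toℚᵘ-/ (+ m) 0) (toℚᵘ-/ (+ n) 0) ⟨
  toℚᵘ (ι m) ℚᵘ.+ toℚᵘ (ι n)  ≈⟨ ℚ.toℚᵘ-homo-+ (ι m) (ι n) ⟨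
  toℚᵘ (ι m ℚ.+ ι n)          ∎)
  where
  open import Relation.Binary.Reasoning.Setoid ℚᵘ.≃-setoid
  drop-1 : + m ℤ.* + 1 ℤ.+ + n ℤ.* + 1 ≡ + (m + n)
  drop-1 = cong₂ ℤ._+_ (ℤ.*-identityʳ (+ m)) (ℤ.*-identityʳ (+ n))

/-* : ∀ m c n d → (+ m / suc c) ℚ.* (+ n / suc d) ≡ + (m * n) / (suc c * suc d)
/-* m c n d = ℚ.toℚᵘ-injective (begin
  toℚᵘ ((+ m / suc c) ℚ.* (+ n / suc d))        ≈⟨ ℚ.toℚᵘ-homo-* (+ m / suc c) (+ n / suc d) ⟩
  toℚᵘ (+ m / suc c) ℚᵘ.* toℚᵘ (+ n / suc d)    ≈⟨ ℚᵘ.*-cong (toℚᵘ-/ (+ m) c) (toℚᵘ-/ (+ n) d) ⟩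
  -- `d + c * suc d` is the predecessor of `suc c * suc d`.
  mkℚᵘ (+ m) c ℚᵘ.* mkℚᵘ (+ n) d                ≈⟨ ℚᵘ.≃-reflexive (cong (λ i → mkℚᵘ i (d + c * suc d)) (sym (ℤ.pos-* m n))) ⟩
  mkℚᵘ (+ (m * n)) (d + c * suc d)              ≈⟨ toℚᵘ-/ (+ (m * n)) (d + c * suc d) ⟨
  toℚᵘ (+ (m * n) / (suc c * suc d))            ∎)
  where open import Relation.Binary.Reasoning.Setoid ℚᵘ.≃-setoid

ι-* : ∀ m n → ι (m * n) ≡ ι m ℚ.* ι n
ι-* m n = sym (/-* m 0 n 0)

/-cross : ∀ m c n d → m * suc d ≡ n * suc c → + m / suc c ≡ + n / suc d
/-cross m c n d eq = ℚ.fromℚᵘ-cong {mkℚᵘ (+ m) c} {mkℚᵘ (+ n) d}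
  (*≡* (trans (sym (ℤ.pos-* m (suc d))) (trans (cong +_ eq) (ℤ.pos-* n (suc c)))))

/-as-* : ∀ m d → + m / suc d ≡ ι m ℚ.* (+ 1 / suc d)
/-as-* m d = trans (/-cross m d (m * 1) (d + 0) (lemma m d)) (sym (/-* m 0 1 d))
  where
  lemma : ∀ m d → m * (1 + (d + 0)) ≡ m * 1 * suc d
  lemma = solve-∀

1/d*d≡1 : ∀ d → (+ 1 / suc d) ℚ.* ι (suc d) ≡ 1ℚ
1/d*d≡1 d = trans (/-* 1 d (suc d) 0) (/-cross (1 * suc d) (d * 1) 1 0 (lemma d))
  where
  lemma : ∀ d → 1 * suc d * 1 ≡ 1 * suc (d * 1)
  lemma = solve-∀

-- Non-zero instances instead of explicit successors let `d` be a power of two, with `2 ^ suc m`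
-- unfolding to `2 * 2 ^ m`.
1/d≡2/2d : ∀ d .{{_ : NonZero d}} .{{_ : NonZero (2 * d)}} → + 1 / d ≡ ι 2 ℚ.* (+ 1 / (2 * d))
1/d≡2/2d (suc d) = trans (/-cross 1 d 2 (d + suc (d + 0)) (lemma d)) (/-as-* 2 (d + suc (d + 0)))
  where
  lemma : ∀ d → 1 * suc (d + suc (d + 0)) ≡ 2 * suc d
  lemma = solve-∀

1/2^-suc : ∀ m → 1/2^ m ≡ ι 2 ℚ.* 1/2^ suc m
1/2^-suc m = 1/d≡2/2d (2 ^ m) {{m^n≢0 2 m}} {{m^n≢0 2 (suc m)}}

-- Telescoping

-- At t = 2, with S = p + 1, T = 2p + 1, u = 1/T, K = 2m + 1, v = 1/K,
-- and x = O m, y = O p.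
telescope : ∀ t h c c′ b b₁ b₂ S N T K u v x y →
  b₁ ℚ.* S ≡ N ℚ.* b →
  c′ ℚ.* (b₂ ℚ.* S) ≡ t ℚ.* (K ℚ.* (c ℚ.* b)) →
  K ≡ T ℚ.+ t ℚ.* N →
  u ℚ.* T ≡ 1ℚ →
  v ℚ.* K ≡ 1ℚ →
  t ℚ.* (t ℚ.* h) ℚ.* (S ℚ.* u) ℚ.* c ℚ.* b₁ ℚ.* (x ℚ.- (y ℚ.+ u))
    ℚ.+ t ℚ.* h ℚ.* c ℚ.* b ℚ.* (x ℚ.- y)
  ≡ h ℚ.* (S ℚ.* u) ℚ.* c′ ℚ.* b₂ ℚ.* ((x ℚ.+ v) ℚ.- (y ℚ.+ u))
telescope t h c c′ b b₁ b₂ S N T K u v x y b₁S c′b₂S K≡ uT vK = begin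
  t ℚ.* (t ℚ.* h) ℚ.* (S ℚ.* u) ℚ.* c ℚ.* b₁ ℚ.* (x ℚ.- (y ℚ.+ u))
    ℚ.+ t ℚ.* h ℚ.* c ℚ.* b ℚ.* (x ℚ.- y)
    ≡⟨ solve 9 (λ t h S u c b₁ x y b →
         t :* (t :* h) :* (S :* u) :* c :* b₁ :* (x :- (y :+ u)) :+ t :* h :* c :* b :* (x :- y)
         := t :* h :* c :* (t :* u :* (b₁ :* S) :* (x :- (y :+ u)) :+ b :* (x :- y)))
       refl t h S u c b₁ x y b ⟩
  t ℚ.* h ℚ.* c ℚ.* (t ℚ.* u ℚ.* (b₁ ℚ.* S) ℚ.* (x ℚ.- (y ℚ.+ u)) ℚ.+ b ℚ.* (x ℚ.- y))
    ≡⟨ cong (λ z → t ℚ.* h ℚ.* c ℚ.* (t ℚ.* u ℚ.* z ℚ.* (x ℚ.- (y ℚ.+ u)) ℚ.+ b ℚ.* (x ℚ.- y))) b₁S ⟩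
  t ℚ.* h ℚ.* c ℚ.* (t ℚ.* u ℚ.* (N ℚ.* b) ℚ.* (x ℚ.- (y ℚ.+ u)) ℚ.+ b ℚ.* (x ℚ.- y))
    -- Split `x - y` as `(x - (y + u)) + u`. The last `u` is kept as `u * 1ℚ` so that this 1 can
    -- become `v * K`.
    ≡⟨ solve 8 (λ t h u c N x y b →
         t :* h :* c :* (t :* u :* (N :* b) :* (x :- (y :+ u)) :+ b :* (x :- y))
         := t :* h :* c :* b :* ((con 1ℚ :+ u :* (t :* N)) :* (x :- (y :+ u)) :+ u :* con 1ℚ))
       refl t h u c N x y b ⟩
  t ℚ.* h ℚ.* c ℚ.* b ℚ.* ((1ℚ ℚ.+ u ℚ.* (t ℚ.* N)) ℚ.* (x ℚ.- (y ℚ.+ u)) ℚ.+ u ℚ.* 1ℚ)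
    ≡⟨ cong₂ (λ z₁ z₂ → t ℚ.* h ℚ.* c ℚ.* b ℚ.* (z₁ ℚ.* (x ℚ.- (y ℚ.+ u)) ℚ.+ u ℚ.* z₂)) uK (sym vK) ⟩
  t ℚ.* h ℚ.* c ℚ.* b ℚ.* (u ℚ.* K ℚ.* (x ℚ.- (y ℚ.+ u)) ℚ.+ u ℚ.* (v ℚ.* K))
    -- Both terms now contain `u * K`; factoring it out adds `v` to `x`, the increment of the odd
    -- harmonic number.
    ≡⟨ solve 9 (λ t h u c K x y b v →
         t :* h :* c :* b :* (u :* K :* (x :- (y :+ u)) :+ u :* (v :* K))
         := h :* u :* (t :* (K :* (c :* b))) :* ((x :+ v) :- (y :+ u)))
       refl t h u c K x y b v ⟩
  h ℚ.* u ℚ.* (t ℚ.* (K ℚ.* (c ℚ.* b))) ℚ.* ((x ℚ.+ v) ℚ.- (y ℚ.+ u))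
    ≡⟨ cong (λ z → h ℚ.* u ℚ.* z ℚ.* ((x ℚ.+ v) ℚ.- (y ℚ.+ u))) c′b₂S ⟨
  h ℚ.* u ℚ.* (c′ ℚ.* (b₂ ℚ.* S)) ℚ.* ((x ℚ.+ v) ℚ.- (y ℚ.+ u))
    ≡⟨ solve 6 (λ h u c′ b₂ S d →
         h :* u :* (c′ :* (b₂ :* S)) :* d := h :* (S :* u) :* c′ :* b₂ :* d)
       refl h u c′ b₂ S ((x ℚ.+ v) ℚ.- (y ℚ.+ u)) ⟩
  h ℚ.* (S ℚ.* u) ℚ.* c′ ℚ.* b₂ ℚ.* ((x ℚ.+ v) ℚ.- (y ℚ.+ u)) ∎
  where
  open ≡-Reasoning
  open +-*-Solver
  uK : 1ℚ ℚ.+ u ℚ.* (t ℚ.* N) ≡ u ℚ.* K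
  uK = begin
    1ℚ ℚ.+ u ℚ.* (t ℚ.* N)       ≡⟨ cong (ℚ._+ u ℚ.* (t ℚ.* N)) uT ⟨
    u ℚ.* T ℚ.+ u ℚ.* (t ℚ.* N)  ≡⟨ ℚ.*-distribˡ-+ u T (t ℚ.* N) ⟨
    u ℚ.* (T ℚ.+ t ℚ.* N)        ≡⟨ cong (u ℚ.*_) K≡ ⟨
    u ℚ.* K                      ∎

-- Induction on `n`

summand : ℕ → ℕ → ℚ
summand p k = (1/2^ (2 * k)) ℚ.* binom (2 * (k + p)) (k + p) ℚ.* binom (k + p) k ℚ.* (O (k + p) ℚ.- O p)

-- Successors replace `+ 1` so that `O` unfolds. As `suc n + p` computes to `suc (n + p)`, the same
-- C(2m,m) occurs here and in `summand p (suc n)`.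
closedForm : ℕ → ℕ → ℚ
closedForm p n = (1/2^ suc (2 * n)) ℚ.* (+ suc p / suc (2 * p)) ℚ.* binom (2 * suc (n + p)) (suc (n + p))
  ℚ.* binom (suc (n + p)) n ℚ.* (O (suc (n + p)) ℚ.- O (suc p))

closedForm-step : ∀ p n → closedForm p n ℚ.+ summand p (suc n) ≡ closedForm p (suc n)
closedForm-step p n = begin
  closedForm p n ℚ.+ summand p (suc n)
    -- `h` is the power of 1/2 in `closedForm p (suc n)`, the smallest of the three; the other two
    -- are 4h and 2h.
    ≡⟨ cong₂ (λ z₁ z₂ → z₁ ℚ.* (+ suc p / suc (2 * p)) ℚ.* c ℚ.* b₁ ℚ.* (O m ℚ.- O (suc p))
                          ℚ.+ z₂ ℚ.* c ℚ.* b ℚ.* (O m ℚ.- O p)) quadruple (1/2^-suc (2 * suc n)) ⟩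
  ι 2 ℚ.* (ι 2 ℚ.* h) ℚ.* (+ suc p / suc (2 * p)) ℚ.* c ℚ.* b₁ ℚ.* (O m ℚ.- O (suc p))
    ℚ.+ ι 2 ℚ.* h ℚ.* c ℚ.* b ℚ.* (O m ℚ.- O p)
    ≡⟨ cong (λ z → ι 2 ℚ.* (ι 2 ℚ.* h) ℚ.* z ℚ.* c ℚ.* b₁ ℚ.* (O m ℚ.- O (suc p))
                     ℚ.+ ι 2 ℚ.* h ℚ.* c ℚ.* b ℚ.* (O m ℚ.- O p)) (/-as-* (suc p) (2 * p)) ⟩
  ι 2 ℚ.* (ι 2 ℚ.* h) ℚ.* (ι (suc p) ℚ.* u) ℚ.* c ℚ.* b₁ ℚ.* (O m ℚ.- (O p ℚ.+ u))
    ℚ.+ ι 2 ℚ.* h ℚ.* c ℚ.* b ℚ.* (O m ℚ.- O p)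
    -- `O (suc p)` and `O (suc m)` are by definition `O p + u` and `O m + v`.
    ≡⟨ telescope (ι 2) h c c′ b b₁ b₂ (ι suc p) (ι suc n) (ι suc (2 * p)) (ι suc (2 * m)) u v (O m) (O p)
         b₁S c′b₂S K≡ (1/d*d≡1 (2 * p)) (1/d*d≡1 (2 * m)) ⟩
  h ℚ.* (ι (suc p) ℚ.* u) ℚ.* c′ ℚ.* b₂ ℚ.* ((O m ℚ.+ v) ℚ.- (O p ℚ.+ u))
    ≡⟨ cong (λ z → h ℚ.* z ℚ.* c′ ℚ.* b₂ ℚ.* ((O m ℚ.+ v) ℚ.- (O p ℚ.+ u))) (/-as-* (suc p) (2 * p)) ⟨
  closedForm p (suc n) ∎
  where
  open ≡-Reasoning
  m = suc n + p
  h = 1/2^ suc (2 * suc n)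
  c = binom (2 * m) m
  c′ = binom (2 * suc m) (suc m)
  b = binom m (suc n)
  b₁ = binom m n
  b₂ = binom (suc m) (suc n)
  u = + 1 / suc (2 * p)
  v = + 1 / suc (2 * m)

  quadruple : 1/2^ suc (2 * n) ≡ ι 2 ℚ.* (ι 2 ℚ.* h)
  quadruple = begin
    1/2^ suc (2 * n)                ≡⟨ 1/2^-suc (suc (2 * n)) ⟩
    ι 2 ℚ.* 1/2^ suc (suc (2 * n))  ≡⟨ cong (λ k → ι 2 ℚ.* 1/2^ k) (2*suc n) ⟨
    ι 2 ℚ.* 1/2^ (2 * suc n)        ≡⟨ cong (ι 2 ℚ.*_) (1/2^-suc (2 * suc n)) ⟩
    ι 2 ℚ.* (ι 2 ℚ.* h)             ∎
    where
    2*suc : ∀ n → 2 * suc n ≡ suc (suc (2 * n))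
    2*suc = solve-∀

  -- Both products equal m C(n+p,n), by the two absorption identities.
  b₁S : b₁ ℚ.* ι suc p ≡ ι suc n ℚ.* b
  b₁S = begin
    b₁ ℚ.* ι suc p          ≡⟨ ι-* (m C n) (suc p) ⟨
    ι ((m C n) * suc p)       ≡⟨ cong ι_ (trans (C-absorbʳ n p) (sym (C-absorbˡ n p))) ⟩
    ι ((m C suc n) * suc n)   ≡⟨ cong ι_ (ℕ.*-comm (m C suc n) (suc n)) ⟩
    ι (suc n * (m C suc n)) ≡⟨ ι-* (suc n) (m C suc n) ⟩
    ι suc n ℚ.* b           ∎

  c′b₂S : c′ ℚ.* (b₂ ℚ.* ι suc p) ≡ ι 2 ℚ.* (ι suc (2 * m) ℚ.* (c ℚ.* b))
  c′b₂S = begin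
    c′ ℚ.* (b₂ ℚ.* ι suc p)
      ≡⟨ cong (c′ ℚ.*_) (ι-* (suc m C suc n) (suc p)) ⟨
    c′ ℚ.* ι ((suc m C suc n) * suc p)
      ≡⟨ ι-* ((2 * suc m) C suc m) ((suc m C suc n) * suc p) ⟨
    ι (((2 * suc m) C suc m) * ((suc m C suc n) * suc p))
      ≡⟨ cong ι_ (C-central-step (suc n) p) ⟩
    ι (2 * (suc (2 * m) * (((2 * m) C m) * (m C suc n))))
      ≡⟨ ι-* 2 (suc (2 * m) * (((2 * m) C m) * (m C suc n))) ⟩
    ι 2 ℚ.* ι (suc (2 * m) * (((2 * m) C m) * (m C suc n)))
      ≡⟨ cong (ι 2 ℚ.*_) (ι-* (suc (2 * m)) (((2 * m) C m) * (m C suc n))) ⟩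
    ι 2 ℚ.* (ι suc (2 * m) ℚ.* ι (((2 * m) C m) * (m C suc n)))
      ≡⟨ cong (λ z → ι 2 ℚ.* (ι suc (2 * m) ℚ.* z)) (ι-* ((2 * m) C m) (m C suc n)) ⟩
    ι 2 ℚ.* (ι suc (2 * m) ℚ.* (c ℚ.* b)) ∎

  K≡ : ι suc (2 * m) ≡ ι suc (2 * p) ℚ.+ ι 2 ℚ.* ι suc n
  K≡ = begin
    ι suc (2 * m)                      ≡⟨ cong ι_ (split n p) ⟩
    ι (suc (2 * p) + 2 * suc n)        ≡⟨ ι-+ (suc (2 * p)) (2 * suc n) ⟩
    ι suc (2 * p) ℚ.+ ι (2 * suc n)    ≡⟨ cong (ι suc (2 * p) ℚ.+_) (ι-* 2 (suc n)) ⟩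
    ι suc (2 * p) ℚ.+ ι 2 ℚ.* ι suc n  ∎
    where
    split : ∀ n p → suc (2 * (suc n + p)) ≡ suc (2 * p) + 2 * suc n
    split = solve-∀

sum-summand : ∀ p n → sum₁ n (summand p) ≡ closedForm p n
-- The harmonic factor at `n = 0` is `O (suc p) - O (suc p)`; `X` collects the other factors.
sum-summand p zero    = sym (trans (cong (X ℚ.*_) (ℚ.+-inverseʳ (O (suc p)))) (ℚ.*-zeroʳ X))
  where X = (1/2^ 1) ℚ.* (+ suc p / suc (2 * p)) ℚ.* binom (2 * suc p) (suc p) ℚ.* binom (suc p) 0
sum-summand p (suc n) = trans (cong (ℚ._+ summand p (suc n)) (sum-summand p n)) (closedForm-step p n)

-- The case `p = 0` and the final form

sum₁-cong : ∀ {f g : ℕ → ℚ} → (∀ k → f k ≡ g k) → ∀ n → sum₁ n f ≡ sum₁ n g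
sum₁-cong f≗g zero    = refl
sum₁-cong f≗g (suc n) = cong₂ ℚ._+_ (sum₁-cong f≗g n) (f≗g (suc n))

-- At `p = 0` the second binomial coefficient is C(k,k) = 1 and `O 0` is 0.
summand-0 : ∀ k → O k ℚ.* (1/2^ (2 * k)) ℚ.* binom (2 * k) k ≡ summand 0 k
summand-0 k = begin
  O k ℚ.* w ℚ.* c                          ≡⟨ solve 3 (λ o w c → o :* w :* c := w :* c :* con 1ℚ :* (o :- con 0ℚ)) refl (O k) w c ⟩
  w ℚ.* c ℚ.* 1ℚ ℚ.* (O k ℚ.- 0ℚ)          ≡⟨ cong (λ j → w ℚ.* c ℚ.* ι j ℚ.* (O k ℚ.- 0ℚ)) (nCn≡1 k) ⟨
  w ℚ.* c ℚ.* binom k k ℚ.* (O k ℚ.- 0ℚ)   ≡⟨ cong (λ j → w ℚ.* binom (2 * j) j ℚ.* binom j k ℚ.* (O j ℚ.- 0ℚ)) (ℕ.+-identityʳ k) ⟨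
  summand 0 k                              ∎
  where
  open ≡-Reasoning
  open +-*-Solver
  w = 1/2^ (2 * k)
  c = binom (2 * k) k

-- The factor n+1 comes from C(n+1,n); the fraction (p+1)/(2p+1) and `O 1` both compute to 1.
closedForm-0 : ∀ n → closedForm 0 n
  ≡ (+ (n + 1) / 1) ℚ.* (1/2^ (2 * n + 1)) ℚ.* binom (2 * (n + 1)) (n + 1) ℚ.* (O (n + 1) ℚ.- 1ℚ)
closedForm-0 n = begin
  closedForm 0 n
    ≡⟨ cong (λ j → w ℚ.* 1ℚ ℚ.* binom (2 * suc j) (suc j) ℚ.* binom (suc j) n ℚ.* (O (suc j) ℚ.- 1ℚ)) (ℕ.+-identityʳ n) ⟩
  w ℚ.* 1ℚ ℚ.* c ℚ.* binom (suc n) n ℚ.* (O (suc n) ℚ.- 1ℚ)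
    ≡⟨ cong (λ j → w ℚ.* 1ℚ ℚ.* c ℚ.* ι j ℚ.* (O (suc n) ℚ.- 1ℚ)) [1+n]Cn≡1+n ⟩
  w ℚ.* 1ℚ ℚ.* c ℚ.* ι suc n ℚ.* (O (suc n) ℚ.- 1ℚ)
    ≡⟨ solve 4 (λ w c N d → w :* con 1ℚ :* c :* N :* d := N :* w :* c :* d) refl w c (ι suc n) (O (suc n) ℚ.- 1ℚ) ⟩
  ι suc n ℚ.* w ℚ.* c ℚ.* (O (suc n) ℚ.- 1ℚ)
    ≡⟨ cong₂ (λ i j → ι i ℚ.* (1/2^ j) ℚ.* binom (2 * i) i ℚ.* (O i ℚ.- 1ℚ)) (ℕ.+-comm 1 n) (ℕ.+-comm 1 (2 * n)) ⟩
  _ ∎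
  where
  open ≡-Reasoning
  open +-*-Solver
  w = 1/2^ suc (2 * n)
  c = binom (2 * suc n) (suc n)
  [1+n]Cn≡1+n : suc n C n ≡ suc n
  [1+n]Cn≡1+n = trans (nCk≡nC[n∸k] (ℕ.n≤1+n n)) (trans (cong (suc n C_) (ℕ.m+n∸n≡m 1 n)) (nC1≡n (suc n)))

closedForm-+1 : ∀ p n → closedForm p n
  ≡ (1/2^ (2 * n + 1)) ℚ.* (+ (p + 1) / suc (2 * p)) ℚ.* binom (2 * (n + p + 1)) (n + p + 1)
      ℚ.* binom (n + p + 1) n ℚ.* (O (n + p + 1) ℚ.- O (p + 1))
closedForm-+1 p n rewrite ℕ.+-comm (2 * n) 1 | ℕ.+-comm (n + p) 1 | ℕ.+-comm p 1 = refl

theorem11 : (∀ (n p : ℕ) →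
    (∑[1≤ k ≤ n ] ((1/2^ (2 * k)) ℚ.* binom (2 * (k + p)) (k + p) ℚ.* binom (k + p) k ℚ.* (O (k + p) ℚ.- O p)))
    ≡ (1/2^ (2 * n + 1)) ℚ.* (+ (p + 1) / suc (2 * p)) ℚ.* binom (2 * (n + p + 1)) (n + p + 1)
    ℚ.* binom (n + p + 1) n ℚ.* (O (n + p + 1) ℚ.- O (p + 1)))
    ×
    (∀ (n : ℕ) →
    (∑[1≤ k ≤ n ] (O k ℚ.* (1/2^ (2 * k)) ℚ.* binom (2 * k) k))
    ≡ (+ (n + 1) / 1) ℚ.* (1/2^ (2 * n + 1)) ℚ.* binom (2 * (n + 1)) (n + 1) ℚ.* (O (n + 1) ℚ.- 1ℚ))
theorem11 =
  (λ n p → trans (sum-summand p n) (closedForm-+1 p n)) ,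
  (λ n → trans (sum₁-cong summand-0 n) (trans (sum-summand 0 n) (closedForm-0 n)))
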